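{- For $n\ge 0$, $k\ge 1$, $r\le n+k$, $$F(n+k+r;\,n+k-r,\,n)=\sum_{t=0}^{k-2}\left[\binom{n-k+r+2}{n-t}-\binom{n-k+r+2}{n+t+3}\right]F(2k-2;\,2t+2,\,t)$$ $$\qquad+\sum_{s=0}^{k-1}\sum_{t=0}^{k-1}\binom{n-k+r+2}{s+1}\left[\binom{n-k+r+2}{n-t+1}-\binom{n-k+r+2}{n+t+2}\right]F(2k-2;\,2t,\,s+t).$$
   Context: $F(m;n_1,n_2)$ denotes the number of Gessel walks with exactly $m$ steps from $(0,0)$ to $(n_1,n_2)$: lattice walks starting at the origin, each of whose $m$ steps is one of West $(-1,0)$, North-East $(1,1)$, East $(1,0)$, South-West $(-1,-1)$, and which remain in the first quadrant $\{(i,j): i\ge 0,\ j\ge 0\}$. In particular $F(m;n_1,n_2)=0$ if $n_1<0$ or $n_2<0$, and $F(0;n_1,n_2)=1$ if $n_1=n_2=0$ and $0$ otherwise. Here $n,k,r$ are integers and $\binom{a}{b}$ denotes a binomial coefficient.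
   Formalization: The hypothesis n−k+r+2 ≥ 0 is added; without it the identity fails under the usual conventions for a negative upper index, e.g. n=0, k=3, r=0 gives 1 on the left but 0, 11 or 12 on the right. -}

module Defs where

open import Data.Integer using (ℤ; +_; -[1+_]; 0ℤ; 1ℤ; -1ℤ; _+_; _*_; _^_; _≤_; _≤?_)
import Data.Integer.Properties as ℤ
open import Data.List using (List; []; _∷_; length; map; foldr; foldl; filter; upTo; cartesianProductWith)
open import Data.List.Relation.Unary.All using (All; all?)
open import Data.List.Scans.Base using (scanl)
open import Data.Nat as ℕ using (ℕ; zero; suc)
open import Data.Nat.Combinatorics using (_C_)
open import Data.Product using (_×_; _,_)
open import Data.Product.Properties using (≡-dec)
open import Relation.Binary.PropositionalEquality using (_≡_)
open import Relation.Nullary using (Dec)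
open import Relation.Nullary.Decidable using (_×-dec_)

Point : Set
Point = ℤ × ℤ

origin : Point
origin = 0ℤ , 0ℤ

data Step : Set where
  W NE E SW : Step

move : Point → Step → Point
move (i , j) W  = i + -1ℤ , j
move (i , j) NE = i + 1ℤ  , j + 1ℤ
move (i , j) E  = i + 1ℤ  , j
move (i , j) SW = i + -1ℤ , j + -1ℤ

InQuadrant : Point → Set
InQuadrant (i , j) = 0ℤ ≤ i × 0ℤ ≤ j

-- scanl lists every point visited, both ends included.
IsGesselWalkTo : Point → List Step → Set
IsGesselWalkTo p w = All InQuadrant (scanl move origin w) × foldl move origin w ≡ p

inQuadrant? : (p : Point) → Dec (InQuadrant p)
inQuadrant? (i , j) = (0ℤ ≤? i) ×-dec (0ℤ ≤? j)

isGesselWalkTo? : (p : Point) (w : List Step) → Dec (IsGesselWalkTo p w)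
isGesselWalkTo? p w =
  all? inQuadrant? (scanl move origin w) ×-dec ≡-dec ℤ._≟_ ℤ._≟_ (foldl move origin w) p

-- All words of length m, each listed exactly once.
words : ℕ → List (List Step)
words zero    = [] ∷ []
words (suc m) = cartesianProductWith _∷_ (W ∷ NE ∷ E ∷ SW ∷ []) (words m)

F : ℤ → ℤ → ℤ → ℤ
F (+ m)    n₁ n₂ = + length (filter (isGesselWalkTo? (n₁ , n₂)) (words m))
F -[1+ _ ] _  _  = 0ℤ

-- The coefficient a(a-1)⋯(a-b+1)/b!, which vanishes for b < 0.  For a negative
-- upper index -(1+a) it equals (-1)^b C(a+b,b).
binom : ℤ → ℤ → ℤ
binom _        -[1+ _ ] = 0ℤ
binom (+ a)    (+ b)    = + (a C b)
binom -[1+ a ] (+ b)    = -1ℤ ^ b * + ((a ℕ.+ b) C b)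

-- The sum of f t over the integers 0 ≤ t ≤ N, empty for N < 0.
sumUpTo : ℤ → (ℤ → ℤ) → ℤ
sumUpTo (+ N)    f = foldr _+_ 0ℤ (map (λ t → f (+ t)) (upTo (suc N)))
sumUpTo -[1+ _ ] f = 0ℤ

infix 5 sumUpTo
syntax sumUpTo N (λ t → x) = ∑[ t ≤ N ] x

{-# OPTIONS --safe #-}
module Submission where

-- In the coordinates i and d = 2j - i every step changes both by ±1, independently.
-- Cut a walk after 2k-2 steps. The remaining N = n-k+r+2 steps must end at d = N-2, so
-- the cut point has d ≥ -2, and only d/2 + 1 of these steps decrease d; this already
-- forces j ≥ 0. Hence the remaining steps are counted by a product: a binomial
-- coefficient for d, and the reflection principle in i = -1 for i.

open import Defs
open import Data.Bool using (Bool; true; false; if_then_else_; _∧_)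
open import Data.Integer using (ℤ; +_; -[1+_]; 0ℤ; 1ℤ; -1ℤ; _+_; _-_; _*_; ∣_∣; _≤_; +≤+; _≟_; _≤?_)
open import Data.Integer.Properties
open import Data.Integer.Tactic.RingSolver using (solve-∀)
open import Data.List using (List; []; _∷_; _++_; length; map; foldr; foldl; filter; applyUpTo; upTo; cartesianProductWith)
open import Data.List.Relation.Unary.All using (all?)
open import Data.List.Scans.Base using (scanl)
open import Data.Nat as ℕ using (ℕ; zero; suc; z≤n; s≤s)
open import Data.Nat.Combinatorics using (_C_; nCk+nC[k+1]≡[n+1]C[k+1])
import Data.Nat.Properties as ℕ
open import Data.Product using (_×_; _,_; proj₁; proj₂)
open import Data.Product.Properties using (≡-dec)
open import Function using (_∘_)
open import Relation.Binary.PropositionalEquality using (_≡_; _≢_; refl; sym; trans; cong; cong₂; subst; module ≡-Reasoning)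
open import Relation.Nullary using (¬_; Dec; yes; no; does; contradiction)
open import Relation.Nullary.Decidable using (_×-dec_)
open ≡-Reasoning

-- Finite sums of integers over lists.

module _ {A : Set} where

  ∑ : (A → ℤ) → List A → ℤ
  ∑ f xs = foldr _+_ 0ℤ (map f xs)

  ∑-cong : ∀ {f g : A → ℤ} → (∀ x → f x ≡ g x) → ∀ xs → ∑ f xs ≡ ∑ g xs
  ∑-cong f≗g []       = refl
  ∑-cong f≗g (x ∷ xs) = cong₂ _+_ (f≗g x) (∑-cong f≗g xs)

  ∑-zero : ∀ xs → ∑ (λ _ → 0ℤ) xs ≡ 0ℤ
  ∑-zero []       = refl
  ∑-zero (_ ∷ xs) = trans (+-identityˡ _) (∑-zero xs)

  ∑-+ : ∀ (f g : A → ℤ) xs → ∑ (λ x → f x + g x) xs ≡ ∑ f xs + ∑ g xs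
  ∑-+ f g []       = refl
  ∑-+ f g (x ∷ xs) = trans (cong (λ z → f x + g x + z) (∑-+ f g xs)) (interchange (f x) (g x) _ _)
    where
    interchange : ∀ a b c d → a + b + (c + d) ≡ a + c + (b + d)
    interchange = solve-∀

  ∑-* : ∀ c (f : A → ℤ) xs → ∑ (λ x → c * f x) xs ≡ c * ∑ f xs
  ∑-* c f []       = sym (*-zeroʳ c)
  ∑-* c f (x ∷ xs) = trans (cong (λ z → c * f x + z) (∑-* c f xs)) (sym (*-distribˡ-+ c (f x) _))

  ∑-++ : ∀ (f : A → ℤ) xs ys → ∑ f (xs ++ ys) ≡ ∑ f xs + ∑ f ys
  ∑-++ f []       ys = sym (+-identityˡ _)
  ∑-++ f (x ∷ xs) ys = trans (cong (λ z → f x + z) (∑-++ f xs ys)) (sym (+-assoc (f x) _ _))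

∑-map : ∀ {A B : Set} (f : B → ℤ) (g : A → B) xs → ∑ f (map g xs) ≡ ∑ (f ∘ g) xs
∑-map f g []       = refl
∑-map f g (x ∷ xs) = cong (λ z → f (g x) + z) (∑-map f g xs)

∑-cartesianProductWith : ∀ {A B C : Set} (h : C → ℤ) (f : A → B → C) xs ys →
  ∑ h (cartesianProductWith f xs ys) ≡ ∑ (λ x → ∑ (h ∘ f x) ys) xs
∑-cartesianProductWith h f []       ys = refl
∑-cartesianProductWith h f (x ∷ xs) ys = begin
  ∑ h (map (f x) ys ++ cartesianProductWith f xs ys)       ≡⟨ ∑-++ h (map (f x) ys) _ ⟩
  ∑ h (map (f x) ys) + ∑ h (cartesianProductWith f xs ys)  ≡⟨ cong₂ _+_ (∑-map h (f x) ys) (∑-cartesianProductWith h f xs ys) ⟩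
  _ ∎

-- Indicators of decidable propositions.

𝟙ᵇ : Bool → ℤ
𝟙ᵇ b = if b then 1ℤ else 0ℤ

𝟙 : {P : Set} → Dec P → ℤ
𝟙 P? = 𝟙ᵇ (does P?)

𝟙-yes : ∀ {P : Set} (P? : Dec P) → P → 𝟙 P? ≡ 1ℤ
𝟙-yes (yes _) _ = refl
𝟙-yes (no ¬p) p = contradiction p ¬p

𝟙-no : ∀ {P : Set} (P? : Dec P) → ¬ P → 𝟙 P? ≡ 0ℤ
𝟙-no (yes p) ¬p = contradiction p ¬p
𝟙-no (no _)  _  = refl

𝟙-*-≡ : ∀ {P : Set} (P? : Dec P) {y z} → (P → y ≡ z) → (¬ P → 0ℤ ≡ z) → 𝟙 P? * y ≡ z
𝟙-*-≡ (yes p) eq _  = trans (*-identityˡ _) (eq p)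
𝟙-*-≡ (no ¬p) _  eq = eq ¬p

𝟙-*-cong : ∀ {P : Set} (P? : Dec P) {y z} → (P → y ≡ z) → 𝟙 P? * y ≡ 𝟙 P? * z
𝟙-*-cong (yes p) eq = cong (1ℤ *_) (eq p)
𝟙-*-cong (no _)  _  = refl

length-filter : ∀ {A : Set} {P : A → Set} (P? : ∀ x → Dec (P x)) xs →
  + length (filter P? xs) ≡ ∑ (𝟙 ∘ P?) xs
length-filter P? []       = refl
length-filter P? (x ∷ xs) with does (P? x)
... | true  = cong (λ z → 1ℤ + z) (length-filter P? xs)
... | false = trans (length-filter P? xs) (sym (+-identityˡ _))

-- Weighted sums over quadrant walks.

steps : List Step
steps = W ∷ NE ∷ E ∷ SW ∷ []

-- Each walk from `p` that stays in the quadrant contributes the weight `h` of its endpoint. An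
-- arbitrary weight, rather than a fixed target, lets the count of the remaining steps serve as the
-- weight of the first ones.
walkSum : ℕ → (Point → ℤ) → Point → ℤ
walkSum zero    h p = 𝟙 (inQuadrant? p) * h p
walkSum (suc m) h p = 𝟙 (inQuadrant? p) * ∑ (λ s → walkSum m h (move p s)) steps

δ : Point → Point → ℤ
δ q p = 𝟙 (≡-dec _≟_ _≟_ p q)

walkFromTo? : ∀ p q w → Dec _
walkFromTo? p q w =
  all? inQuadrant? (scanl move p w) ×-dec ≡-dec _≟_ _≟_ (foldl move p w) q

𝟙ᵇ-∧-assoc : ∀ a b c → 𝟙ᵇ ((a ∧ b) ∧ c) ≡ 𝟙ᵇ a * 𝟙ᵇ (b ∧ c)
𝟙ᵇ-∧-assoc true  b c = sym (*-identityˡ _)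
𝟙ᵇ-∧-assoc false b c = refl

-- Both `scanl` and `foldl` on `s ∷ w` continue from `move p s`, so the test of the starting point
-- factors out of the indicator and the rest is again a walk test. The induction therefore needs an
-- arbitrary start `p`.
∑-walkFromTo : ∀ m p q → ∑ (𝟙 ∘ walkFromTo? p q) (words m) ≡ walkSum m (δ q) p
∑-walkFromTo zero    p q = trans (+-identityʳ _) (𝟙ᵇ-∧-assoc (does (inQuadrant? p)) true _)
∑-walkFromTo (suc m) p q = begin
  ∑ (𝟙 ∘ walkFromTo? p q) (words (suc m))
    ≡⟨ ∑-cartesianProductWith (𝟙 ∘ walkFromTo? p q) _∷_ steps (words m) ⟩
  ∑ (λ s → ∑ (λ w → 𝟙 (walkFromTo? p q (s ∷ w))) (words m)) steps
    ≡⟨ ∑-cong first-step steps ⟩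
  ∑ (λ s → 𝟙 (inQuadrant? p) * walkSum m (δ q) (move p s)) steps
    ≡⟨ ∑-* (𝟙 (inQuadrant? p)) (λ s → walkSum m (δ q) (move p s)) steps ⟩
  walkSum (suc m) (δ q) p ∎
  where
  first-step : ∀ s → ∑ (λ w → 𝟙 (walkFromTo? p q (s ∷ w))) (words m) ≡
                     𝟙 (inQuadrant? p) * walkSum m (δ q) (move p s)
  first-step s = begin
    ∑ (λ w → 𝟙 (walkFromTo? p q (s ∷ w))) (words m)
      ≡⟨ ∑-cong (λ w → 𝟙ᵇ-∧-assoc (does (inQuadrant? p)) _ _) (words m) ⟩
    ∑ (λ w → 𝟙 (inQuadrant? p) * 𝟙 (walkFromTo? (move p s) q w)) (words m)
      ≡⟨ ∑-* (𝟙 (inQuadrant? p)) _ (words m) ⟩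
    𝟙 (inQuadrant? p) * ∑ (𝟙 ∘ walkFromTo? (move p s) q) (words m)
      ≡⟨ cong (𝟙 (inQuadrant? p) *_) (∑-walkFromTo m (move p s) q) ⟩
    𝟙 (inQuadrant? p) * walkSum m (δ q) (move p s) ∎

F-walkSum : ∀ m n₁ n₂ → F (+ m) n₁ n₂ ≡ walkSum m (δ (n₁ , n₂)) origin
F-walkSum m n₁ n₂ =
  trans (length-filter (isGesselWalkTo? (n₁ , n₂)) (words m)) (∑-walkFromTo m origin (n₁ , n₂))

𝟙-idem : ∀ {P : Set} (P? : Dec P) z → 𝟙 P? * z ≡ 𝟙 P? * (𝟙 P? * z)
𝟙-idem (yes _) z = sym (*-identityˡ _)
𝟙-idem (no  _) z = refl

-- The cut point belongs to both pieces and is tested for the quadrant twice; `𝟙-idem` absorbs the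
-- second test.
walkSum-split : ∀ m n h p → walkSum (m ℕ.+ n) h p ≡ walkSum m (walkSum n h) p
walkSum-split zero    zero    h p = 𝟙-idem (inQuadrant? p) _
walkSum-split zero    (suc n) h p = 𝟙-idem (inQuadrant? p) _
walkSum-split (suc m) n       h p =
  cong (𝟙 (inQuadrant? p) *_) (∑-cong (λ s → walkSum-split m n h (move p s)) steps)

walkSum-zero : ∀ m p → walkSum m (λ _ → 0ℤ) p ≡ 0ℤ
walkSum-zero zero    p = *-zeroʳ (𝟙 (inQuadrant? p))
walkSum-zero (suc m) p = trans
  (cong (𝟙 (inQuadrant? p) *_) (trans (∑-cong (λ s → walkSum-zero m (move p s)) steps) (∑-zero steps)))
  (*-zeroʳ (𝟙 (inQuadrant? p)))

walkSum-+ : ∀ m f g p → walkSum m (λ x → f x + g x) p ≡ walkSum m f p + walkSum m g p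
walkSum-+ zero    f g p = *-distribˡ-+ (𝟙 (inQuadrant? p)) _ _
walkSum-+ (suc m) f g p = trans
  (cong (𝟙 (inQuadrant? p) *_) (trans (∑-cong (λ s → walkSum-+ m f g (move p s)) steps) (∑-+ (λ s → walkSum m f (move p s)) (λ s → walkSum m g (move p s)) steps)))
  (*-distribˡ-+ (𝟙 (inQuadrant? p)) _ _)

swap-* : ∀ a b c → a * (b * c) ≡ b * (a * c)
swap-* = solve-∀

walkSum-* : ∀ m c f p → walkSum m (λ x → c * f x) p ≡ c * walkSum m f p
walkSum-* zero    c f p = swap-* (𝟙 (inQuadrant? p)) c (f p)
walkSum-* (suc m) c f p = trans
  (cong (𝟙 (inQuadrant? p) *_) (trans (∑-cong (λ s → walkSum-* m c f (move p s)) steps) (∑-* c (λ s → walkSum m f (move p s)) steps)))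
  (swap-* (𝟙 (inQuadrant? p)) c _)

walkSum-∑ : ∀ {A : Set} m (f : A → Point → ℤ) xs p →
  walkSum m (λ x → ∑ (λ a → f a x) xs) p ≡ ∑ (λ a → walkSum m (f a) p) xs
walkSum-∑ m f []       p = walkSum-zero m p
walkSum-∑ m f (a ∷ xs) p = trans (walkSum-+ m (f a) _ p) (cong (λ z → walkSum m (f a) p + z) (walkSum-∑ m f xs p))

walkSum-sumUpTo : ∀ m K (f : ℤ → Point → ℤ) p →
  walkSum m (λ x → ∑[ t ≤ K ] f t x) p ≡ ∑[ t ≤ K ] walkSum m (f t) p
walkSum-sumUpTo m (+ K)    f p = walkSum-∑ m (f ∘ +_) (upTo (suc K)) p
walkSum-sumUpTo m -[1+ _ ] f p = walkSum-zero m p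

-- The steps change i and 2j - i by ±1 independently of each other; x and y count
-- the steps increasing i and 2j - i respectively.
walkSum-cong : ∀ m {f g : Point → ℤ} i j →
  (∀ x y {i′ j′} → x ℕ.≤ m → y ℕ.≤ m → i′ ≡ i + + 2 * + x - + m → j′ ≡ j + + x + + y - + m →
     InQuadrant (i′ , j′) → f (i′ , j′) ≡ g (i′ , j′)) →
  walkSum m f (i , j) ≡ walkSum m g (i , j)
walkSum-cong zero {f} {g} i j f≗g =
  𝟙-*-cong (inQuadrant? (i , j)) (f≗g 0 0 z≤n z≤n (eq₁ i) (eq₂ j))
  where
  eq₁ : ∀ i → i ≡ i + + 2 * 0ℤ - 0ℤ
  eq₁ = solve-∀
  eq₂ : ∀ j → j ≡ j + 0ℤ + 0ℤ - 0ℤ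
  eq₂ = solve-∀
walkSum-cong (suc m) {f} {g} i j f≗g = cong (𝟙 (inQuadrant? (i , j)) *_) (∑-cong go steps)
  where
  go : ∀ s → walkSum m f (move (i , j) s) ≡ walkSum m g (move (i , j) s)
  go W  = walkSum-cong m (i + -1ℤ) j λ x y x≤ y≤ i≡ j≡ →
    f≗g x (suc y) (ℕ.m≤n⇒m≤1+n x≤) (s≤s y≤) (trans i≡ (eq₁ i (+ x) (+ m))) (trans j≡ (eq₂ j (+ x) (+ y) (+ m)))
    where
    eq₁ : ∀ i x m → (i + -1ℤ) + + 2 * x - m ≡ i + + 2 * x - (1ℤ + m)
    eq₁ = solve-∀
    eq₂ : ∀ j x y m → j + x + y - m ≡ j + x + (1ℤ + y) - (1ℤ + m)
    eq₂ = solve-∀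
  go NE = walkSum-cong m (i + 1ℤ) (j + 1ℤ) λ x y x≤ y≤ i≡ j≡ →
    f≗g (suc x) (suc y) (s≤s x≤) (s≤s y≤) (trans i≡ (eq₁ i (+ x) (+ m))) (trans j≡ (eq₂ j (+ x) (+ y) (+ m)))
    where
    eq₁ : ∀ i x m → (i + 1ℤ) + + 2 * x - m ≡ i + + 2 * (1ℤ + x) - (1ℤ + m)
    eq₁ = solve-∀
    eq₂ : ∀ j x y m → j + 1ℤ + x + y - m ≡ j + (1ℤ + x) + (1ℤ + y) - (1ℤ + m)
    eq₂ = solve-∀
  go E  = walkSum-cong m (i + 1ℤ) j λ x y x≤ y≤ i≡ j≡ →
    f≗g (suc x) y (s≤s x≤) (ℕ.m≤n⇒m≤1+n y≤) (trans i≡ (eq₁ i (+ x) (+ m))) (trans j≡ (eq₂ j (+ x) (+ y) (+ m)))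
    where
    eq₁ : ∀ i x m → (i + 1ℤ) + + 2 * x - m ≡ i + + 2 * (1ℤ + x) - (1ℤ + m)
    eq₁ = solve-∀
    eq₂ : ∀ j x y m → j + x + y - m ≡ j + (1ℤ + x) + y - (1ℤ + m)
    eq₂ = solve-∀
  go SW = walkSum-cong m (i + -1ℤ) (j + -1ℤ) λ x y x≤ y≤ i≡ j≡ →
    f≗g x y (ℕ.m≤n⇒m≤1+n x≤) (ℕ.m≤n⇒m≤1+n y≤) (trans i≡ (eq₁ i (+ x) (+ m))) (trans j≡ (eq₂ j (+ x) (+ y) (+ m)))
    where
    eq₁ : ∀ i x m → (i + -1ℤ) + + 2 * x - m ≡ i + + 2 * x - (1ℤ + m)
    eq₁ = solve-∀
    eq₂ : ∀ j x y m → j + -1ℤ + x + y - m ≡ j + x + y - (1ℤ + m)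
    eq₂ = solve-∀

-- Binomial coefficients and integer inequalities.

binom-Pascal : ∀ N a → binom (+ suc N) a ≡ binom (+ N) a + binom (+ N) (a - 1ℤ)
binom-Pascal N -[1+ m ]    = refl
binom-Pascal N (+ zero)    = refl
binom-Pascal N (+ (suc m)) =
  cong +_ (trans (sym (nCk+nC[k+1]≡[n+1]C[k+1] N m)) (ℕ.+-comm (N C m) _))

binom-0 : ∀ {a} → a ≢ 0ℤ → binom 0ℤ a ≡ 0ℤ
binom-0 { + zero }    a≢0 = contradiction refl a≢0
binom-0 { + (suc _) } _   = refl
binom-0 { -[1+ _ ] }  _   = refl

binom-<0 : ∀ N {a} → ¬ (0ℤ ≤ a) → binom (+ N) a ≡ 0ℤ
binom-<0 N { + _ }      0≰a = contradiction (+≤+ z≤n) 0≰a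
binom-<0 N { -[1+ _ ] } _   = refl

0≤-by : ∀ {a b} → b ≡ a → 0ℤ ≤ a → 0ℤ ≤ b
0≤-by eq = subst (0ℤ ≤_) (sym eq)

0≰-1 : ¬ (0ℤ ≤ -1ℤ)
0≰-1 ()

0≤2*z+1⇒0≤z : ∀ z → 0ℤ ≤ + 2 * z + 1ℤ → 0ℤ ≤ z
0≤2*z+1⇒0≤z (+ _)    _ = +≤+ z≤n
0≤2*z+1⇒0≤z -[1+ n ] p =
  -- For z = -(1+n), the number -1 - z is n ≥ 0; adding it twice to 2z + 1 ≥ 0 leaves -1 ≥ 0.
  contradiction (0≤-by (lin -[1+ n ]) (+-mono-≤ p (+-mono-≤ (+≤+ (z≤n {n})) (+≤+ (z≤n {n}))))) 0≰-1
  where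
  lin : ∀ z → -1ℤ ≡ + 2 * z + 1ℤ + ((-1ℤ - z) + (-1ℤ - z))
  lin = solve-∀

i+1≥0∧i<0⇒i≡-1 : ∀ i → 0ℤ ≤ i + 1ℤ → ¬ (0ℤ ≤ i) → i ≡ -1ℤ
i+1≥0∧i<0⇒i≡-1 (+ _)          _ i≱0 = contradiction (+≤+ z≤n) i≱0
i+1≥0∧i<0⇒i≡-1 -[1+ zero ]    _ _   = refl
i+1≥0∧i<0⇒i≡-1 -[1+ suc _ ]   () _

-- A product formula for the steps after the cut.

-- With e steps decreasing 2j - i still to come, a walk that keeps i ≥ 0 from here on
-- cannot reach j < 0.
Safe : ℤ → ℤ → ℤ → Set
Safe e i j = 0ℤ ≤ i → 0ℤ ≤ e → 0ℤ ≤ j × (0ℤ ≤ e - 1ℤ → 0ℤ ≤ + 2 * j + 1ℤ - e - i)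

module _ {b n : ℤ} (0≤b : 0ℤ ≤ b) where

  -- The free count minus the count reflected in the line i = -1.
  formula : ℕ → ℤ → ℤ → ℤ
  formula N a e = binom (+ N) e * (binom (+ N) a - binom (+ N) (b - a + + N + 1ℤ))

  -- Pascal's rule holds in each factor, and the product of the two rules has one term per step: in
  -- the order `W`, `NE`, `E`, `SW`, a step increasing i lowers `a` and a step decreasing 2j - i
  -- lowers `e`.
  formula-suc : ∀ N a e → formula (suc N) a e ≡
    formula N a e + (formula N (a - 1ℤ) e + (formula N (a - 1ℤ) (e - 1ℤ) + (formula N a (e - 1ℤ) + 0ℤ)))
  formula-suc N a e = begin
    binom (+ suc N) e * (binom (+ suc N) a - binom (+ suc N) (b - a + + suc N + 1ℤ))
      -- In the reflected coefficient the summands of Pascal's rule trade places: the one with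
      -- undiminished index is the reflected term for `a - 1`, the other the one for `a`.
      ≡⟨ cong₂ _*_ (binom-Pascal N e) (cong₂ _-_ (binom-Pascal N a) (trans (binom-Pascal N (b - a + + suc N + 1ℤ))
           (cong₂ (λ x y → binom (+ N) x + binom (+ N) y) (eq₁ b a (+ N)) (eq₂ b a (+ N))))) ⟩
    _ ≡⟨ expand (binom (+ N) e) (binom (+ N) (e - 1ℤ)) (binom (+ N) a) (binom (+ N) (a - 1ℤ)) _ _ ⟩
    _ ∎
    where
    eq₁ : ∀ b a N → b - a + (1ℤ + N) + 1ℤ ≡ b - (a - 1ℤ) + N + 1ℤ
    eq₁ = solve-∀
    eq₂ : ∀ b a N → b - a + (1ℤ + N) + 1ℤ - 1ℤ ≡ b - a + N + 1ℤ
    eq₂ = solve-∀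
    expand : ∀ e e′ a a′ c c′ → (e + e′) * (a + a′ - (c + c′)) ≡
      e * (a - c′) + (e * (a′ - c) + (e′ * (a′ - c) + (e′ * (a - c′) + 0ℤ)))
    expand = solve-∀

  -- Either i = -1, where a start lies on the mirror and the two coefficients cancel, or i ≥ 0 > j,
  -- where `Safe` leaves only e < 0 and the first factor vanishes.
  formula-outside : ∀ N {i j a e} → i ≡ b - + 2 * a + + N → 0ℤ ≤ i + 1ℤ → Safe e i j →
    ¬ InQuadrant (i , j) → 0ℤ ≡ formula N a e
  formula-outside N {i} {j} {a} {e} i≡ i≥-1 safe out with 0ℤ ≤? i
  ... | yes i≥0 = sym (cong (_* (binom (+ N) a - binom (+ N) (b - a + + N + 1ℤ)))
                    (binom-<0 N λ e≥0 → out (i≥0 , proj₁ (safe i≥0 e≥0))))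
  ... | no  i≱0 = sym (trans
    (cong (λ x → binom (+ N) e * (binom (+ N) a - binom (+ N) x)) fixed)
    (trans (cong (binom (+ N) e *_) (+-inverseʳ (binom (+ N) a))) (*-zeroʳ (binom (+ N) e))))
    where
    eq : ∀ b a N → b - a + N + 1ℤ ≡ a + ((b - + 2 * a + N) + 1ℤ)
    eq = solve-∀
    fixed : b - a + + N + 1ℤ ≡ a
    fixed = trans (eq b a (+ N)) (trans
      (cong (λ x → a + (x + 1ℤ)) (trans (sym i≡) (i+1≥0∧i<0⇒i≡-1 i i≥-1 i≱0)))
      (+-identityʳ a))

  formula-zero : ∀ {i j a e} → i ≡ b - + 2 * a + 0ℤ → j ≡ n - a + e → 0ℤ ≤ i →
    δ (b , n) (i , j) ≡ formula 0 a e
  formula-zero {i} {j} {a} {e} i≡ j≡ i≥0 = sym (begin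
    binom 0ℤ e * (binom 0ℤ a - binom 0ℤ (b - a + 0ℤ + 1ℤ))
      ≡⟨ cong (λ x → binom 0ℤ e * (binom 0ℤ a - x)) (binom-0 reflected≢0) ⟩
    binom 0ℤ e * (binom 0ℤ a - 0ℤ)
      ≡⟨ cong (binom 0ℤ e *_) (+-identityʳ _) ⟩
    binom 0ℤ e * binom 0ℤ a
      ≡⟨ unreflected ⟩
    δ (b , n) (i , j) ∎)
    where
    reflected≢0 : b - a + 0ℤ + 1ℤ ≢ 0ℤ
    -- A vanishing reflected index would put i at -2 - b, the mirror image of the target, although b
    -- and i are nonnegative.
    reflected≢0 eq = 0≰-1 (0≤-by lin (+-mono-≤ (+-mono-≤ 0≤b i≥0) (+≤+ (z≤n {1}))))
      where
      lin′ : ∀ b a → -1ℤ ≡ b + (b - + 2 * a + 0ℤ) + 1ℤ - + 2 * (b - a + 0ℤ + 1ℤ)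
      lin′ = solve-∀
      lin : -1ℤ ≡ b + i + 1ℤ
      lin = trans (lin′ b a) (trans (cong₂ (λ x y → b + x + 1ℤ - + 2 * y) (sym i≡) eq) (+-identityʳ _))

    i≡b⇒a≡0 : i ≡ b → a ≡ 0ℤ
    i≡b⇒a≡0 i≡b = *-cancelˡ-≡ (+ 2) a 0ℤ (trans (lin b a) (trans (cong (b -_) (trans (sym i≡) i≡b)) (+-inverseʳ b)))
      where
      lin : ∀ b a → + 2 * a ≡ b - (b - + 2 * a + 0ℤ)
      lin = solve-∀

    unreflected : binom 0ℤ e * binom 0ℤ a ≡ δ (b , n) (i , j)
    -- With no steps left, a = e = 0 describes exactly the target (b , n).
    unreflected with a ≟ 0ℤ
    ... | no a≢0 = trans (cong (binom 0ℤ e *_) (binom-0 a≢0)) (trans (*-zeroʳ (binom 0ℤ e))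
                     (sym (𝟙-no (≡-dec _≟_ _≟_ (i , j) (b , n)) λ eq → a≢0 (i≡b⇒a≡0 (cong proj₁ eq)))))
    ... | yes refl with e ≟ 0ℤ
    ...   | yes refl = sym (𝟙-yes (≡-dec _≟_ _≟_ (i , j) (b , n)) (cong₂ _,_ (trans i≡ (lin₁ b)) (trans j≡ (lin₂ n))))
      where
      lin₁ : ∀ b → b - + 2 * 0ℤ + 0ℤ ≡ b
      lin₁ = solve-∀
      lin₂ : ∀ n → n - 0ℤ + 0ℤ ≡ n
      lin₂ = solve-∀
    ...   | no e≢0 = trans (cong (_* 1ℤ) (binom-0 e≢0))
                       (sym (𝟙-no (≡-dec _≟_ _≟_ (i , j) (b , n)) λ eq → e≢0
                         (trans (lin n e) (trans (cong (_- n) (trans (sym j≡) (cong proj₂ eq))) (+-inverseʳ n)))))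
      where
      lin : ∀ n e → e ≡ n - 0ℤ + e - n
      lin = solve-∀

  -- The equations for i and j say that `a` of the `N` steps increase i and `e` of them decrease 2j
  -- - i. The induction enters points just outside the quadrant, hence `0ℤ ≤ i + 1ℤ`. The bound in
  -- `Safe` survives each step: `W` and `NE` raise 2j - i and keep e, while `E` and `SW` lower both
  -- by 1.
  walkSum-formula : ∀ N {i j a e} → i ≡ b - + 2 * a + + N → j ≡ n - a + e → 0ℤ ≤ i + 1ℤ → Safe e i j →
    walkSum N (δ (b , n)) (i , j) ≡ formula N a e
  walkSum-formula zero {i} {j} {a} {e} i≡ j≡ i≥-1 safe =
    𝟙-*-≡ (inQuadrant? (i , j)) (λ (i≥0 , _) → formula-zero {i} {j} {a} {e} i≡ j≡ i≥0)
      (formula-outside 0 {i} {j} {a} {e} i≡ i≥-1 safe)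
  walkSum-formula (suc N) {i} {j} {a} {e} i≡ j≡ i≥-1 safe =
    𝟙-*-≡ (inQuadrant? (i , j)) inside (formula-outside (suc N) {i} {j} {a} {e} i≡ i≥-1 safe)
    where
    inside : InQuadrant (i , j) →
      ∑ (λ s → walkSum N (δ (b , n)) (move (i , j) s)) steps ≡ formula (suc N) a e
    inside (i≥0 , j≥0) = trans
      (cong₂ _+_ west (cong₂ _+_ northEast (cong₂ _+_ east (cong₂ _+_ southWest refl))))
      (sym (formula-suc N a e))
      where
      i-1≥-1 : 0ℤ ≤ i + -1ℤ + 1ℤ
      i-1≥-1 = 0≤-by (lin i) i≥0
        where
        lin : ∀ i → i + -1ℤ + 1ℤ ≡ i
        lin = solve-∀
      i+1≥-1 : 0ℤ ≤ i + 1ℤ + 1ℤ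
      i+1≥-1 = +-mono-≤ (+-mono-≤ i≥0 (+≤+ (z≤n {1}))) (+≤+ (z≤n {1}))

      i-1≡ : i + -1ℤ ≡ b - + 2 * a + + N
      i-1≡ = trans (cong (_+ -1ℤ) i≡) (lin b a (+ N))
        where
        lin : ∀ b a N → b - + 2 * a + (1ℤ + N) + -1ℤ ≡ b - + 2 * a + N
        lin = solve-∀
      i+1≡ : i + 1ℤ ≡ b - + 2 * (a - 1ℤ) + + N
      i+1≡ = trans (cong (_+ 1ℤ) i≡) (lin b a (+ N))
        where
        lin : ∀ b a N → b - + 2 * a + (1ℤ + N) + 1ℤ ≡ b - + 2 * (a - 1ℤ) + N
        lin = solve-∀

      e-1≥0⇒e≥0 : 0ℤ ≤ e - 1ℤ → 0ℤ ≤ e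
      e-1≥0⇒e≥0 e≥1 = 0≤-by (lin e) (+-mono-≤ e≥1 (+≤+ (z≤n {1})))
        where
        lin : ∀ e → e ≡ e - 1ℤ + 1ℤ
        lin = solve-∀

      west : walkSum N (δ (b , n)) (i + -1ℤ , j) ≡ formula N a e
      west = walkSum-formula N {i + -1ℤ} {j} {a} {e} i-1≡ j≡ i-1≥-1 λ _ e≥0 → j≥0 , λ e≥1 →
        0≤-by (lin e i j) (+-mono-≤ (proj₂ (safe i≥0 e≥0) e≥1) (+≤+ (z≤n {1})))
        where
        lin : ∀ e i j → + 2 * j + 1ℤ - e - (i + -1ℤ) ≡ + 2 * j + 1ℤ - e - i + 1ℤ
        lin = solve-∀

      northEast : walkSum N (δ (b , n)) (i + 1ℤ , j + 1ℤ) ≡ formula N (a - 1ℤ) e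
      northEast = walkSum-formula N {i + 1ℤ} {j + 1ℤ} {a - 1ℤ} {e} i+1≡
        (trans (cong (_+ 1ℤ) j≡) (lin₁ n a e)) i+1≥-1
        λ _ e≥0 → +-mono-≤ j≥0 (+≤+ (z≤n {1})) , λ e≥1 →
        0≤-by (lin₂ e i j) (+-mono-≤ (proj₂ (safe i≥0 e≥0) e≥1) (+≤+ (z≤n {1})))
        where
        lin₁ : ∀ n a e → n - a + e + 1ℤ ≡ n - (a - 1ℤ) + e
        lin₁ = solve-∀
        lin₂ : ∀ e i j → + 2 * (j + 1ℤ) + 1ℤ - e - (i + 1ℤ) ≡ + 2 * j + 1ℤ - e - i + 1ℤ
        lin₂ = solve-∀

      east : walkSum N (δ (b , n)) (i + 1ℤ , j) ≡ formula N (a - 1ℤ) (e - 1ℤ)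
      east = walkSum-formula N {i + 1ℤ} {j} {a - 1ℤ} {e - 1ℤ} i+1≡ (trans j≡ (lin₁ n a e)) i+1≥-1
        λ _ e≥1 → j≥0 , λ _ →
        0≤-by (lin₂ e i j) (proj₂ (safe i≥0 (e-1≥0⇒e≥0 e≥1)) e≥1)
        where
        lin₁ : ∀ n a e → n - a + e ≡ n - (a - 1ℤ) + (e - 1ℤ)
        lin₁ = solve-∀
        lin₂ : ∀ e i j → + 2 * j + 1ℤ - (e - 1ℤ) - (i + 1ℤ) ≡ + 2 * j + 1ℤ - e - i
        lin₂ = solve-∀

      southWest : walkSum N (δ (b , n)) (i + -1ℤ , j + -1ℤ) ≡ formula N a (e - 1ℤ)
      southWest = walkSum-formula N {i + -1ℤ} {j + -1ℤ} {a} {e - 1ℤ} i-1≡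
        (trans (cong (_+ -1ℤ) j≡) (lin₁ n a e)) i-1≥-1
        λ i≥1 e≥1 →
          -- Only `SW` lowers j. Adding the bound 2j - i ≥ e - 1 to e ≥ 1 and i ≥ 1 gives 2(j - 1) +
          -- 1 ≥ 0, and j ≥ 1 follows by integrality.
          let d≥e-1 = proj₂ (safe i≥0 (e-1≥0⇒e≥0 e≥1)) e≥1 in
          0≤2*z+1⇒0≤z (j + -1ℤ) (0≤-by (lin₂ e i j) (+-mono-≤ d≥e-1 (+-mono-≤ e≥1 i≥1))) ,
          λ _ → 0≤-by (lin₃ e i j) d≥e-1
        where
        lin₁ : ∀ n a e → n - a + e + -1ℤ ≡ n - a + (e - 1ℤ)
        lin₁ = solve-∀
        lin₂ : ∀ e i j → + 2 * (j + -1ℤ) + 1ℤ ≡ + 2 * j + 1ℤ - e - i + (e - 1ℤ + (i + -1ℤ))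
        lin₂ = solve-∀
        lin₃ : ∀ e i j → + 2 * (j + -1ℤ) + 1ℤ - (e - 1ℤ) - (i + -1ℤ) ≡ + 2 * j + 1ℤ - e - i
        lin₃ = solve-∀

-- Sums over ranges with at most one nonzero term.

module _ (f : ℕ → ℤ) where

  ∑-applyUpTo-zero : ∀ g n → (∀ t → f (g t) ≡ 0ℤ) → ∑ f (applyUpTo g n) ≡ 0ℤ
  ∑-applyUpTo-zero g zero    f≡0 = refl
  ∑-applyUpTo-zero g (suc n) f≡0 = cong₂ _+_ (f≡0 0) (∑-applyUpTo-zero (g ∘ suc) n (f≡0 ∘ suc))

  ∑-applyUpTo-single : ∀ g {x K} → x ℕ.≤ K → (∀ t → t ≢ x → f (g t) ≡ 0ℤ) →
    ∑ f (applyUpTo g (suc K)) ≡ f (g x)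
  ∑-applyUpTo-single g {K = K} z≤n f≡0 = trans
    (cong (λ z → f (g 0) + z) (∑-applyUpTo-zero (g ∘ suc) K (λ t → f≡0 (suc t) λ ())))
    (+-identityʳ _)
  ∑-applyUpTo-single g (s≤s x≤K) f≡0 = trans
    (cong₂ _+_ (f≡0 0 λ ()) (∑-applyUpTo-single (g ∘ suc) x≤K λ t t≢x → f≡0 (suc t) (t≢x ∘ ℕ.suc-injective)))
    (+-identityˡ _)

sumUpTo-zero : ∀ K f → (∀ t → f (+ t) ≡ 0ℤ) → sumUpTo K f ≡ 0ℤ
sumUpTo-zero (+ K)    f f≡0 = ∑-applyUpTo-zero (f ∘ +_) _ (suc K) f≡0
sumUpTo-zero -[1+ _ ] f f≡0 = refl

sumUpTo-single : ∀ {x K} f → x ℕ.≤ K → (∀ t → t ≢ x → f (+ t) ≡ 0ℤ) → sumUpTo (+ K) f ≡ f (+ x)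
sumUpTo-single f = ∑-applyUpTo-single (f ∘ +_) _

sumUpTo-cong : ∀ K {f g} → (∀ t → f t ≡ g t) → sumUpTo K f ≡ sumUpTo K g
sumUpTo-cong (+ K)    f≗g = ∑-cong (f≗g ∘ +_) (upTo (suc K))
sumUpTo-cong -[1+ _ ] f≗g = refl

-- Weights supported on the possible cut points.

δ-refl : ∀ p → δ p p ≡ 1ℤ
δ-refl p = 𝟙-yes (≡-dec _≟_ _≟_ p p) refl

*δ-≢ : ∀ c p q → p ≢ q → c * δ q p ≡ 0ℤ
*δ-≢ c p q p≢q = trans (cong (c *_) (𝟙-no (≡-dec _≟_ _≟_ p q) p≢q)) (*-zeroʳ c)

*δ-refl : ∀ c p → c * δ p p ≡ c
*δ-refl c p = trans (cong (c *_) (δ-refl p)) (*-identityʳ c)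

diag : Point → ℤ
diag (i , j) = + 2 * j - i

diag-≢ : ∀ p q u v → diag p ≡ + 2 * u → diag q ≡ + 2 * v → u ≢ v → p ≢ q
diag-≢ p q u v dp dq u≢v p≡q =
  u≢v (*-cancelˡ-≡ (+ 2) u v (trans (sym dp) (trans (cong diag p≡q) dq)))

P₁ : ℤ → Point
P₁ t = + 2 * t + + 2 , t

P₂ : ℤ → ℤ → Point
P₂ s t = + 2 * t , s + t

diag-P₁ : ∀ t → diag (P₁ t) ≡ + 2 * -1ℤ
diag-P₁ = lin
  where
  lin : ∀ t → + 2 * t - (+ 2 * t + + 2) ≡ + 2 * -1ℤ
  lin = solve-∀

diag-P₂ : ∀ s t → diag (P₂ s t) ≡ + 2 * s
diag-P₂ = lin
  where
  lin : ∀ s t → + 2 * (s + t) - + 2 * t ≡ + 2 * s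
  lin = solve-∀

module _ (K : ℤ) (κ : ℕ) (c₁ : ℤ → ℤ) (c₂ : ℤ → ℤ → ℤ) where

  term₁ : Point → ℤ → ℤ
  term₁ p t = c₁ t * δ (P₁ t) p

  term₂ : Point → ℤ → ℤ → ℤ
  term₂ p s t = c₂ s t * δ (P₂ s t) p

  row₂ : Point → ℤ → ℤ
  row₂ p s = sumUpTo (+ κ) (term₂ p s)

  -- The right-hand side as a weight on cut points: summed over walks by `walkSum-pointSum`, each
  -- point mass turns into a value of `F`.
  pointSum : Point → ℤ
  pointSum p = sumUpTo K (term₁ p) + sumUpTo (+ κ) (row₂ p)

  -- `diag` separates the two families and the rows of the second, and the abscissa separates the
  -- points of a row, so a single term survives.
  pointSum-P₂ : ∀ s t → s ℕ.≤ κ → t ℕ.≤ κ → pointSum (P₂ (+ s) (+ t)) ≡ c₂ (+ s) (+ t)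
  pointSum-P₂ s t s≤κ t≤κ = trans (cong₂ _+_ none one) (+-identityˡ _)
    where
    p : Point
    p = P₂ (+ s) (+ t)

    none : sumUpTo K (term₁ p) ≡ 0ℤ
    none = sumUpTo-zero K (term₁ p) λ t′ → *δ-≢ (c₁ (+ t′)) p (P₁ (+ t′))
      (diag-≢ p (P₁ (+ t′)) (+ s) -1ℤ (diag-P₂ (+ s) (+ t)) (diag-P₁ (+ t′)) λ ())

    one : sumUpTo (+ κ) (row₂ p) ≡ c₂ (+ s) (+ t)
    one = begin
      sumUpTo (+ κ) (row₂ p)
        ≡⟨ sumUpTo-single (row₂ p) s≤κ (λ s′ s′≢s → sumUpTo-zero (+ κ) (term₂ p (+ s′)) λ t′ →
             *δ-≢ (c₂ (+ s′) (+ t′)) p (P₂ (+ s′) (+ t′))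
               (diag-≢ p (P₂ (+ s′) (+ t′)) (+ s) (+ s′) (diag-P₂ (+ s) (+ t)) (diag-P₂ (+ s′) (+ t′))
                 (s′≢s ∘ sym ∘ +-injective))) ⟩
      sumUpTo (+ κ) (term₂ p (+ s))
        ≡⟨ sumUpTo-single (term₂ p (+ s)) t≤κ (λ t′ t′≢t →
             *δ-≢ (c₂ (+ s) (+ t′)) p (P₂ (+ s) (+ t′)) λ eq →
               t′≢t (sym (+-injective (*-cancelˡ-≡ (+ 2) (+ t) (+ t′) (cong proj₁ eq))))) ⟩
      c₂ (+ s) (+ t) * δ p p
        ≡⟨ *δ-refl (c₂ (+ s) (+ t)) p ⟩
      c₂ (+ s) (+ t) ∎

  pointSum-diag<0 : ∀ p d → diag p ≡ + 2 * -[1+ d ] → pointSum p ≡ sumUpTo K (term₁ p)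
  pointSum-diag<0 p d dp = trans
    (cong (λ z → sumUpTo K (term₁ p) + z)
      (sumUpTo-zero (+ κ) (row₂ p) λ s → sumUpTo-zero (+ κ) (term₂ p (+ s)) λ t →
        *δ-≢ (c₂ (+ s) (+ t)) p (P₂ (+ s) (+ t))
          (diag-≢ p (P₂ (+ s) (+ t)) -[1+ d ] (+ s) dp (diag-P₂ (+ s) (+ t)) λ ())))
    (+-identityʳ _)

  -- The bound `K` is an integer since it will be κ - 1, which is -1 for κ = 0; `T` witnesses that
  -- the range is nonempty.
  pointSum-P₁ : ∀ t T → K ≡ + T → t ℕ.≤ T → pointSum (P₁ (+ t)) ≡ c₁ (+ t)
  pointSum-P₁ t T K≡T t≤T = begin
    pointSum p
      ≡⟨ pointSum-diag<0 p 0 (diag-P₁ (+ t)) ⟩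
    sumUpTo K (term₁ p)
      ≡⟨ cong (λ L → sumUpTo L (term₁ p)) K≡T ⟩
    sumUpTo (+ T) (term₁ p)
      ≡⟨ sumUpTo-single (term₁ p) t≤T (λ t′ t′≢t → *δ-≢ (c₁ (+ t′)) p (P₁ (+ t′)) λ eq →
           t′≢t (sym (+-injective (cong proj₂ eq)))) ⟩
    c₁ (+ t) * δ p p
      ≡⟨ *δ-refl (c₁ (+ t)) p ⟩
    c₁ (+ t) ∎
    where
    p : Point
    p = P₁ (+ t)

  pointSum-diag<-2 : ∀ p d → diag p ≡ + 2 * -[1+ suc d ] → pointSum p ≡ 0ℤ
  pointSum-diag<-2 p d dp = trans (pointSum-diag<0 p (suc d) dp)
    (sumUpTo-zero K (term₁ p) λ t → *δ-≢ (c₁ (+ t)) p (P₁ (+ t))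
      (diag-≢ p (P₁ (+ t)) -[1+ suc d ] -1ℤ dp (diag-P₁ (+ t)) λ ()))

  walkSum-pointSum : ∀ m → walkSum m pointSum origin ≡
    (∑[ t ≤ K ] (c₁ t * F (+ m) (+ 2 * t + + 2) t)) +
    (∑[ s ≤ + κ ] (∑[ t ≤ + κ ] (c₂ s t * F (+ m) (+ 2 * t) (s + t))))
  walkSum-pointSum m = trans
    (walkSum-+ m (λ p → sumUpTo K (term₁ p)) (λ p → sumUpTo (+ κ) (row₂ p)) origin)
    (cong₂ _+_ (weighted c₁ P₁ K)
      (trans (walkSum-sumUpTo m (+ κ) (λ s p → row₂ p s) origin)
        (sumUpTo-cong (+ κ) λ s → weighted (c₂ s) (P₂ s) (+ κ))))
    where
    weighted : ∀ (c : ℤ → ℤ) (P : ℤ → Point) L →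
      walkSum m (λ p → ∑[ t ≤ L ] (c t * δ (P t) p)) origin ≡
      (∑[ t ≤ L ] (c t * F (+ m) (proj₁ (P t)) (proj₂ (P t))))
    weighted c P L = trans (walkSum-sumUpTo m L (λ t p → c t * δ (P t) p) origin)
      (sumUpTo-cong L λ t → trans
        (walkSum-* m (c t) (δ (P t)) origin)
        (cong (c t *_) (sym (F-walkSum m (proj₁ (P t)) (proj₂ (P t))))))

-- Cutting the walk and matching the coefficients.

module _ {b n : ℤ} (0≤b : 0ℤ ≤ b) (N : ℕ) (b+N≡ : b + + N ≡ + 2 * n + + 2) where

  coeff₁ : ℤ → ℤ
  coeff₁ t = binom (+ N) (n - t) - binom (+ N) (n + t + + 3)

  coeff₂ : ℤ → ℤ → ℤ
  coeff₂ s t = binom (+ N) (s + + 1) * (binom (+ N) (n - t + + 1) - binom (+ N) (n + t + + 2))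

  by-b+N : ∀ {x} c y → x ≡ c + (b + + N) → c + (+ 2 * n + + 2) ≡ y → x ≡ y
  by-b+N c y x≡ ≡y = trans x≡ (trans (cong (λ z → c + z) b+N≡) ≡y)

  i≡ : ∀ t → + 2 * t ≡ b - + 2 * (n - t + + 1) + + N
  i≡ t = sym (by-b+N (0ℤ - + 2 * (n - t + + 1)) _ (lin₁ b n t (+ N)) (lin₂ n t))
    where
    lin₁ : ∀ b n t N → b - + 2 * (n - t + + 1) + N ≡ 0ℤ - + 2 * (n - t + + 1) + (b + N)
    lin₁ = solve-∀
    lin₂ : ∀ n t → 0ℤ - + 2 * (n - t + + 1) + (+ 2 * n + + 2) ≡ + 2 * t
    lin₂ = solve-∀

  reflected≡ : ∀ t → b - (n - t + + 1) + + N + 1ℤ ≡ n + t + + 2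
  reflected≡ t = by-b+N (t - n) _ (lin₁ b n t (+ N)) (lin₂ n t)
    where
    lin₁ : ∀ b n t N → b - (n - t + + 1) + N + 1ℤ ≡ t - n + (b + N)
    lin₁ = solve-∀
    lin₂ : ∀ n t → t - n + (+ 2 * n + + 2) ≡ n + t + + 2
    lin₂ = solve-∀

  even≥-1 : ∀ t → 0ℤ ≤ + 2 * + t + 1ℤ
  even≥-1 t = 0≤-by (lin (+ t)) (+≤+ (z≤n {t ℕ.+ t ℕ.+ 1}))
    where
    lin : ∀ t → + 2 * t + 1ℤ ≡ t + t + 1ℤ
    lin = solve-∀

  -- From i = 2t exactly n - t + 1 of the `N` steps increase i, and e = (2j - i)/2 + 1 of them
  -- decrease 2j - i. Keeping `e` as the parameter covers the rows 2j - i = 2s (e = s + 1), the row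
  -- -2 (e = 0) and everything lower (e < 0).
  walkSum-N : ∀ t e {j} → j ≡ n - (n - + t + + 1) + e → Safe e (+ 2 * + t) j →
    walkSum N (δ (b , n)) (+ 2 * + t , j) ≡ coeff₂ (e - + 1) (+ t)
  walkSum-N t e {j} j≡ safe = trans
    (walkSum-formula 0≤b N {+ 2 * + t} {j} {n - + t + + 1} {e} (i≡ (+ t)) j≡ (even≥-1 t) safe)
    (cong₂ (λ x y → binom (+ N) x * (binom (+ N) (n - + t + + 1) - binom (+ N) y)) (lin e) (reflected≡ (+ t)))
    where
    lin : ∀ e → e ≡ e - + 1 + + 1
    lin = solve-∀

  walkSum-P₂ : ∀ s t → walkSum N (δ (b , n)) (P₂ (+ s) (+ t)) ≡ coeff₂ (+ s) (+ t)
  walkSum-P₂ s t = trans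
    (walkSum-N t (+ s + + 1) (lin₁ n (+ s) (+ t)) λ _ _ →
      +≤+ z≤n , λ _ → 0≤-by (lin₂ (+ s) (+ t)) (+≤+ (z≤n {s})))
    (cong (λ x → coeff₂ x (+ t)) (lin₃ (+ s)))
    where
    lin₁ : ∀ n s t → s + t ≡ n - (n - t + + 1) + (s + + 1)
    lin₁ = solve-∀
    lin₂ : ∀ s t → + 2 * (s + t) + 1ℤ - (s + + 1) - + 2 * t ≡ s
    lin₂ = solve-∀
    lin₃ : ∀ s → s + + 1 - + 1 ≡ s
    lin₃ = solve-∀

  walkSum-P₁ : ∀ t → walkSum N (δ (b , n)) (P₁ (+ t)) ≡ coeff₁ (+ t)
  walkSum-P₁ t = begin
    walkSum N (δ (b , n)) (P₁ (+ t))
      ≡⟨ cong (λ i → walkSum N (δ (b , n)) (i , + t)) (lin₁ (+ t)) ⟩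
    walkSum N (δ (b , n)) (+ 2 * + suc t , + t)
      -- The abscissa 2t + 2 is 2(t + 1), hence `suc t`. With e = 0 only `W` and `NE` remain, so j
      -- never decreases and the first binomial coefficient is 1.
      ≡⟨ walkSum-N (suc t) 0ℤ (lin₂ n (+ t)) (λ _ _ → +≤+ z≤n , λ ()) ⟩
    1ℤ * (binom (+ N) (n - + suc t + + 1) - binom (+ N) (n + + suc t + + 2))
      ≡⟨ *-identityˡ _ ⟩
    binom (+ N) (n - + suc t + + 1) - binom (+ N) (n + + suc t + + 2)
      ≡⟨ cong₂ (λ x y → binom (+ N) x - binom (+ N) y) (lin₃ n (+ t)) (lin₄ n (+ t)) ⟩
    coeff₁ (+ t) ∎
    where
    lin₁ : ∀ t → + 2 * t + + 2 ≡ + 2 * (1ℤ + t)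
    lin₁ = solve-∀
    lin₂ : ∀ n t → t ≡ n - (n - (1ℤ + t) + + 1) + 0ℤ
    lin₂ = solve-∀
    lin₃ : ∀ n t → n - (1ℤ + t) + + 1 ≡ n - t
    lin₃ = solve-∀
    lin₄ : ∀ n t → n + (1ℤ + t) + + 2 ≡ n + t + + 3
    lin₄ = solve-∀

  -- A negative `e` makes `Safe` vacuous and the first binomial coefficient zero.
  walkSum-low : ∀ t z {j} → j ≡ n - (n - + t + + 1) + -[1+ z ] →
    walkSum N (δ (b , n)) (+ 2 * + t , j) ≡ 0ℤ
  walkSum-low t z j≡ = walkSum-N t -[1+ z ] j≡ λ _ ()

  module _ {K : ℤ} (κ : ℕ) (K≡ : K ≡ + κ - + 1) where

    R : Point → ℤ
    R = pointSum K κ coeff₁ coeff₂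

    -- Here 2j - i = 2 (y - κ): it is nonnegative, equal to -2, or too low to reach (b , n).
    walkSum≡pointSum : ∀ t y {j} → t ℕ.≤ κ → y ℕ.≤ κ ℕ.+ κ → j ≡ + t + (+ y - + κ) → 0ℤ ≤ j →
      walkSum N (δ (b , n)) (+ 2 * + t , j) ≡ R (+ 2 * + t , j)
    walkSum≡pointSum t y {j} t≤κ y≤ j≡ j≥0 with κ ℕ.≤? y
    ... | yes κ≤y with ℕ.m≤n⇒∃[o]m+o≡n κ≤y
    ...   | s , refl = subst (λ j → walkSum N (δ (b , n)) (+ 2 * + t , j) ≡ R (+ 2 * + t , j))
        (sym (trans j≡ (lin (+ t) (+ κ) (+ s))))
        (trans (walkSum-P₂ s t) (sym (pointSum-P₂ K κ coeff₁ coeff₂ s t (ℕ.+-cancelˡ-≤ κ s κ y≤) t≤κ)))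
      where
      lin : ∀ t κ s → t + (κ + s - κ) ≡ s + t
      lin = solve-∀
    walkSum≡pointSum t y {j} t≤κ y≤ j≡ j≥0 | no κ≰y with ℕ.m≤n⇒∃[o]m+o≡n (ℕ.≰⇒> κ≰y)
    -- Here κ = y + z + 2, so 2j - i = -2(z + 2) and e = -(z + 1).
    walkSum≡pointSum t y {j} t≤κ y≤ j≡ j≥0 | no κ≰y | suc z , refl =
      trans (walkSum-low t z (trans j≡ (lin₁ n (+ t) (+ y) (+ z))))
        (sym (pointSum-diag<-2 K κ coeff₁ coeff₂ (+ 2 * + t , j) z
          (trans (cong (λ j → + 2 * j - + 2 * + t) j≡) (lin₂ (+ t) (+ y) (+ z)))))
      where
      lin₁ : ∀ n t y z → t + (y - (1ℤ + (y + (1ℤ + z)))) ≡ n - (n - t + + 1) + (0ℤ - (1ℤ + z))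
      lin₁ = solve-∀
      lin₂ : ∀ t y z → + 2 * (t + (y - (1ℤ + (y + (1ℤ + z))))) - + 2 * t ≡ + 2 * (0ℤ - (1ℤ + (1ℤ + z)))
      lin₂ = solve-∀
    walkSum≡pointSum zero y {j} t≤κ y≤ j≡ j≥0 | no κ≰y | zero , refl =
      contradiction (subst (0ℤ ≤_) (trans j≡ (lin (+ y))) j≥0) 0≰-1
      where
      lin : ∀ y → 0ℤ + (y - (1ℤ + (y + 0ℤ))) ≡ -1ℤ
      lin = solve-∀
    walkSum≡pointSum (suc t) y {j} t≤κ y≤ j≡ j≥0 | no κ≰y | zero , refl =
      subst (λ p → walkSum N (δ (b , n)) p ≡ R p)
        (cong₂ _,_ (lin₁ (+ t)) (sym (trans j≡ (lin₂ (+ t) (+ y)))))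
        (trans (walkSum-P₁ t)
          (sym (pointSum-P₁ K κ coeff₁ coeff₂ t (y ℕ.+ 0) (trans K≡ (lin₃ (+ (y ℕ.+ 0)))) (ℕ.s≤s⁻¹ t≤κ))))
      where
      lin₁ : ∀ t → + 2 * t + + 2 ≡ + 2 * (1ℤ + t)
      lin₁ = solve-∀
      lin₂ : ∀ t y → 1ℤ + t + (y - (1ℤ + (y + 0ℤ))) ≡ t
      lin₂ = solve-∀
      lin₃ : ∀ κ → 1ℤ + κ - + 1 ≡ κ
      lin₃ = solve-∀

    F-split : F (+ (κ ℕ.+ κ ℕ.+ N)) b n ≡
      (∑[ t ≤ K ] (coeff₁ t * F (+ (κ ℕ.+ κ)) (+ 2 * t + + 2) t)) +
      (∑[ s ≤ + κ ] (∑[ t ≤ + κ ] (coeff₂ s t * F (+ (κ ℕ.+ κ)) (+ 2 * t) (s + t))))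
    F-split = begin
      F (+ (κ ℕ.+ κ ℕ.+ N)) b n
        ≡⟨ F-walkSum (κ ℕ.+ κ ℕ.+ N) b n ⟩
      walkSum (κ ℕ.+ κ ℕ.+ N) (δ (b , n)) origin
        ≡⟨ walkSum-split (κ ℕ.+ κ) N (δ (b , n)) origin ⟩
      walkSum (κ ℕ.+ κ) (walkSum N (δ (b , n))) origin
        ≡⟨ walkSum-cong (κ ℕ.+ κ) 0ℤ 0ℤ reached ⟩
      walkSum (κ ℕ.+ κ) R origin
        ≡⟨ walkSum-pointSum K κ coeff₁ coeff₂ (κ ℕ.+ κ) ⟩
      _ ∎
      where
      reached : ∀ x y {i j} → x ℕ.≤ κ ℕ.+ κ → y ℕ.≤ κ ℕ.+ κ →
        i ≡ 0ℤ + + 2 * + x - + (κ ℕ.+ κ) → j ≡ 0ℤ + + x + + y - + (κ ℕ.+ κ) → InQuadrant (i , j) →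
        walkSum N (δ (b , n)) (i , j) ≡ R (i , j)
      -- After 2κ steps i = 2(x - κ), so i ≥ 0 forces x ≥ κ and t = x - κ is a natural number, at
      -- most κ.
      reached x y {i} {j} x≤ y≤ i≡′ j≡′ (i≥0 , j≥0) with ℕ.m≤n⇒∃[o]m+o≡n κ≤x
        where
        lin : ∀ x κ → + 2 * (x - κ) + 1ℤ ≡ 0ℤ + + 2 * x - (κ + κ) + 1ℤ
        lin = solve-∀
        κ≤x : κ ℕ.≤ x
        κ≤x = drop‿+≤+ (0≤i-j⇒j≤i (0≤2*z+1⇒0≤z (+ x - + κ)
          (0≤-by (trans (lin (+ x) (+ κ)) (cong (_+ 1ℤ) (sym i≡′))) (+-mono-≤ i≥0 (+≤+ (z≤n {1}))))))
      ... | t , refl = subst (λ i → walkSum N (δ (b , n)) (i , j) ≡ R (i , j))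
          (sym (trans i≡′ (lin₁ (+ κ) (+ t))))
          (walkSum≡pointSum t y (ℕ.+-cancelˡ-≤ κ t κ x≤) y≤ (trans j≡′ (lin₂ (+ κ) (+ t) (+ y))) j≥0)
        where
        lin₁ : ∀ κ t → 0ℤ + + 2 * (κ + t) - (κ + κ) ≡ + 2 * t
        lin₁ = solve-∀
        lin₂ : ∀ κ t y → 0ℤ + (κ + t) + y - (κ + κ) ≡ t + (y - κ)
        lin₂ = solve-∀

-- The identity in the variables n, k, r.

-- Variables tied by equations stand for the integer expressions in n, k, r, so that matching on
-- `refl` replaces them by naturals; κ is k - 1. The equation for `K₁` is passed on unmatched.
theorem3-ℕ : ∀ {n b m M N′ K₁ K₂} (κ N : ℕ) → 0ℤ ≤ b → b + + N ≡ + 2 * n + + 2 →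
  m ≡ + (κ ℕ.+ κ ℕ.+ N) → M ≡ + (κ ℕ.+ κ) → N′ ≡ + N → K₁ ≡ + κ - + 1 → K₂ ≡ + κ →
  F m b n ≡
    (∑[ t ≤ K₁ ] ((binom N′ (n - t) - binom N′ (n + t + + 3)) * F M (+ 2 * t + + 2) t))
    + (∑[ s ≤ K₂ ] (∑[ t ≤ K₂ ]
        (binom N′ (s + + 1) * (binom N′ (n - t + + 1) - binom N′ (n + t + + 2)) * F M (+ 2 * t) (s + t))))
theorem3-ℕ κ N 0≤b b+N≡ refl refl refl K₁≡ refl = F-split 0≤b N b+N≡ κ K₁≡

-- The bound on r makes the final abscissa n + k - r nonnegative, and `0ℤ ≤ n - k + r + + 2` says
-- that the walk has at least the 2k - 2 steps before the cut.
theorem3 : (n k r : ℤ) → 0ℤ ≤ n → 1ℤ ≤ k → r ≤ n + k → 0ℤ ≤ n - k + r + + 2 →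
    F (n + k + r) (n + k - r) n ≡
    (∑[ t ≤ k - + 2 ]
    ((binom (n - k + r + + 2) (n - t) - binom (n - k + r + + 2) (n + t + + 3))
    * F (+ 2 * k - + 2) (+ 2 * t + + 2) t))
    + (∑[ s ≤ k - + 1 ] (∑[ t ≤ k - + 1 ]
    (binom (n - k + r + + 2) (s + + 1)
    * (binom (n - k + r + + 2) (n - t + + 1) - binom (n - k + r + + 2) (n + t + + 2))
    * F (+ 2 * k - + 2) (+ 2 * t) (s + t))))
theorem3 n (+ zero) r 0≤n 1≤k r≤n+k 0≤N = contradiction 1≤k λ { (+≤+ ()) }
theorem3 n k@(+ suc κ) r 0≤n 1≤k r≤n+k 0≤N =
  theorem3-ℕ κ ∣ N ∣ (i≤j⇒0≤j-i r≤n+k) (trans (cong (λ z → n + k - r + z) +∣N∣≡N) (lin₁ n k r))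
    (trans (lin₂ n (+ κ) r) (cong (λ z → + κ + + κ + z) (sym +∣N∣≡N)))
    (lin₃ (+ κ)) (sym +∣N∣≡N) (lin₄ (+ κ)) (lin₅ (+ κ))
  where
  N = n - k + r + + 2
  +∣N∣≡N : + ∣ N ∣ ≡ N
  +∣N∣≡N = 0≤i⇒+∣i∣≡i 0≤N
  lin₁ : ∀ n k r → n + k - r + (n - k + r + + 2) ≡ + 2 * n + + 2
  lin₁ = solve-∀
  lin₂ : ∀ n κ r → n + (1ℤ + κ) + r ≡ κ + κ + (n - (1ℤ + κ) + r + + 2)
  lin₂ = solve-∀
  lin₃ : ∀ κ → + 2 * (1ℤ + κ) - + 2 ≡ κ + κ
  lin₃ = solve-∀
  lin₄ : ∀ κ → 1ℤ + κ - + 2 ≡ κ - + 1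
  lin₄ = solve-∀
  lin₅ : ∀ κ → 1ℤ + κ - + 1 ≡ κ
  lin₅ = solve-∀
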